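{- Let $\lambda$ be a nonzero real number, $x$ real, and $n\ge0$ an integer. Then $$\sum_{k=0}^{n}\beta_{k,\lambda}(x)\,S_{1,\lambda}(n,k)=n!\sum_{k=0}^{n}\binom{x}{k}\frac{\lambda^{n-k}(1)_{n-k+1,\frac{1}{\lambda}}}{(n-k+1)!}.$$
   Context: For real $y$, $\mu\neq 0$ and integer $k\ge0$: $(y)_{0,\mu}=1$, $(y)_{k,\mu}=y(y-\mu)\cdots(y-(k-1)\mu)$ (used with $\mu=\lambda$ and $\mu=1/\lambda$); $(y)_0=1$, $(y)_k=y(y-1)\cdots(y-k+1)$. The degenerate exponential is $e_\lambda^x(t)=\sum_{k\ge0}(x)_{k,\lambda}t^k/k!=(1+\lambda t)^{x/\lambda}$, $e_\lambda(t)=e^1_\lambda(t)$. The degenerate Bernoulli polynomials are defined by $\frac{t}{e_\lambda(t)-1}e_\lambda^x(t)=\sum_{n\ge0}\beta_{n,\lambda}(x)\frac{t^n}{n!}$. The degenerate Stirling numbers of the first kind are defined by $(x)_{n}=\sum_{k=0}^{n}S_{1,\lambda}(n,k)(x)_{k,\lambda}$ ($n\ge0$). -}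

module Defs where

open import Algebra.Bundles using (CommutativeRing; Semiring)
import Algebra.Definitions.RawSemiring as RawSemiringDefinitions
import Algebra.Properties.CommutativeMonoid.Sum as CommutativeMonoidSum
import Algebra.Properties.Monoid.Sum as MonoidSum
import Algebra.Properties.Ring as RingProperties
import Algebra.Properties.Semiring.Sum as SemiringSum
open import Algebra.Structures using (IsCommutativeRing)
open import Data.Fin.Base as Fin using (Fin; toℕ; inject₁; fromℕ)
import Data.Fin.Properties as Fin
open import Data.Integer.Base using (+_)
open import Data.Nat.Base as ℕ using (ℕ; zero; suc; _∸_; _!; _⊔_)
import Data.Nat.Properties as ℕ
open import Data.Product.Base using (∃; _,_) renaming (_×_ to _∧_)
import Data.Rational.Base
open import Data.Rational.Base as ℚ using (ℚ; 0ℚ; 1ℚ; ½)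
import Data.Rational.Properties as ℚ
import Data.Rational.Solver as ℚSolver
open import Data.Vec.Functional using (Vector; _∷_)
open import Level using (0ℓ)
open import Relation.Binary.PropositionalEquality using (_≡_; _≢_; refl; sym; trans; cong; cong₂; subst; subst₂)
import Relation.Binary.Reasoning.Setoid as SetoidReasoning
open import Relation.Nullary.Decidable using (yes; no)
open import Relation.Nullary.Negation using (contradiction)

module _ where
  open Data.Rational.Base using (_+_; _*_; _-_; -_; ∣_∣; _<_; _≤_)
  open ℚSolver.+-*-Solver

  -- The inverse of a rational, with the junk value 0 at 0.
  recipℚ : ℚ → ℚ
  recipℚ p with p ℚ.≟ 0ℚ
  ... | yes _   = 0ℚ
  ... | no p≢0 = (ℚ.1/ p) {{ℚ.≢-nonZero p≢0}}

  abstract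
    recipℚ-inverse : ∀ {p} → p ≢ 0ℚ → p * recipℚ p ≡ 1ℚ
    recipℚ-inverse {p} p≢0 with p ℚ.≟ 0ℚ
    ... | yes p≡0 = contradiction p≡0 p≢0
    ... | no  q   = ℚ.*-inverseʳ p {{ℚ.≢-nonZero q}}

    0<⇒≢0 : ∀ {p} → 0ℚ < p → p ≢ 0ℚ
    0<⇒≢0 0<p p≡0 = ℚ.<-irrefl (sym p≡0) 0<p

    *-pos : ∀ {p q} → 0ℚ < p → 0ℚ < q → 0ℚ < p * q
    *-pos {p} {q} 0<p 0<q = subst (_< p * q) (ℚ.*-zeroʳ p)
      (ℚ.*-monoʳ-<-pos p {{ℚ.positive 0<p}} 0<q)

    recipℚ-pos : ∀ {p} → 0ℚ < p → 0ℚ < recipℚ p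
    recipℚ-pos {p} 0<p = ℚ.*-cancelˡ-<-nonNeg p
      {{ℚ.nonNegative (ℚ.<⇒≤ 0<p)}}
      (subst₂ _<_ (sym (ℚ.*-zeroʳ p)) (sym (recipℚ-inverse (0<⇒≢0 0<p)))
        (ℚ.positive⁻¹ 1ℚ))

    half-pos : ∀ {ε} → 0ℚ < ε → 0ℚ < ½ * ε
    half-pos = *-pos (ℚ.positive⁻¹ ½)

    half+half : ∀ ε → ½ * ε + ½ * ε ≡ ε
    half+half = solve 1 (λ e → con ½ :* e :+ con ½ :* e := e) refl

    ∣-∣-diag : ∀ p {ε} → 0ℚ < ε → ∣ p - p ∣ < ε
    ∣-∣-diag p {ε} 0<ε = subst (λ z → ∣ z ∣ < ε) (sym (ℚ.+-inverseʳ p)) 0<ε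

    ∣-∣-sym : ∀ p q → ∣ p - q ∣ ≡ ∣ q - p ∣
    ∣-∣-sym p q = trans
      (cong ∣_∣ (solve 2 (λ a b → a :- b := :- (b :- a)) refl p q))
      (ℚ.∣-p∣≡∣p∣ (q - p))

    sum<ε : ∀ {p q ε} → ∣ p ∣ < ½ * ε → ∣ q ∣ < ½ * ε → ∣ p + q ∣ < ε
    sum<ε {p} {q} {ε} p< q< = subst (∣ p + q ∣ <_) (half+half ε)
      (ℚ.≤-<-trans (ℚ.∣p+q∣≤∣p∣+∣q∣ p q) (ℚ.+-mono-< p< q<))

    add-close : ∀ {a b c d ε} → ∣ a - c ∣ < ½ * ε → ∣ b - d ∣ < ½ * ε →
                ∣ (a + b) - (c + d) ∣ < ε
    add-close {a} {b} {c} {d} {ε} p q = subst (λ z → ∣ z ∣ < ε)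
      (solve 4 (λ a b c d → (a :- c) :+ (b :- d) := (a :+ b) :- (c :+ d)) refl a b c d)
      (sum<ε p q)

    trans-close : ∀ {a b c ε} → ∣ a - b ∣ < ½ * ε → ∣ b - c ∣ < ½ * ε → ∣ a - c ∣ < ε
    trans-close {a} {b} {c} {ε} p q = subst (λ z → ∣ z ∣ < ε)
      (solve 3 (λ a b c → (a :- b) :+ (b :- c) := a :- c) refl a b c)
      (sum<ε p q)

    neg-close : ∀ {a b ε} → ∣ a - b ∣ < ε → ∣ (- a) - (- b) ∣ < ε
    neg-close {a} {b} {ε} p = subst (_< ε)
      (trans (∣-∣-sym a b)
        (cong ∣_∣ (solve 2 (λ a b → b :- a := (:- a) :- (:- b)) refl a b)))
      p

    scaled<ε : ∀ {a b A ε} → 0ℚ < A → ∣ a ∣ < A → ∣ b ∣ < ε * recipℚ A → ∣ a * b ∣ < ε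
    scaled<ε {a} {b} {A} {ε} 0<A a< b< = ℚ.≤-<-trans
      (subst (_≤ A * ∣ b ∣) (sym (ℚ.∣p*q∣≡∣p∣*∣q∣ a b))
        (ℚ.*-monoʳ-≤-nonNeg ∣ b ∣ {{ℚ.∣-∣-nonNeg b}} (ℚ.<⇒≤ a<)))
      (subst (A * ∣ b ∣ <_) eq (ℚ.*-monoʳ-<-pos A {{ℚ.positive 0<A}} b<))
      where
      eq : A * (ε * recipℚ A) ≡ ε
      eq = trans (solve 3 (λ a e r → a :* (e :* r) := e :* (a :* r)) refl A ε (recipℚ A))
        (trans (cong (ε *_) (recipℚ-inverse (0<⇒≢0 0<A))) (ℚ.*-identityʳ ε))

    mul-close : ∀ {a b c d A D ε} → 0ℚ < A → 0ℚ < D → ∣ a ∣ < A → ∣ d ∣ < D →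
                ∣ b - d ∣ < (½ * ε) * recipℚ A → ∣ a - c ∣ < (½ * ε) * recipℚ D →
                ∣ a * b - c * d ∣ < ε
    mul-close {a} {b} {c} {d} {A} {D} {ε} 0<A 0<D a< d< p q = subst (λ z → ∣ z ∣ < ε)
      (solve 4 (λ a b c d → a :* (b :- d) :+ d :* (a :- c) := a :* b :- c :* d) refl a b c d)
      (sum<ε (scaled<ε 0<A a< p) (scaled<ε 0<D d< q))

    bound : ∀ {a b} → ∣ a - b ∣ < 1ℚ → ∣ a ∣ < 1ℚ + ∣ b ∣
    bound {a} {b} p = ℚ.≤-<-trans
      (subst (λ z → ∣ z ∣ ≤ ∣ a - b ∣ + ∣ b ∣)
        (solve 2 (λ a b → (a :- b) :+ b := a) refl a b)
        (ℚ.∣p+q∣≤∣p∣+∣q∣ (a - b) b))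
      (ℚ.+-monoˡ-< ∣ b ∣ p)

    bound-pos : ∀ b → 0ℚ < 1ℚ + ∣ b ∣
    bound-pos b = ℚ.+-mono-<-≤ (ℚ.positive⁻¹ 1ℚ) (ℚ.0≤∣p∣ b)

    ∣∣-pos⇒≢0 : ∀ {a ε} → 0ℚ < ε → ε ≤ ∣ a ∣ → a ≢ 0ℚ
    ∣∣-pos⇒≢0 0<ε ε≤ refl = ℚ.<-irrefl refl (ℚ.<-≤-trans 0<ε ε≤)

    inverse-expand : ∀ a b r s → (r - s) * (a * b) ≡ b * (a * r) - a * (b * s)
    inverse-expand = solve 4 (λ a b r s →
      (r :- s) :* (a :* b) := b :* (a :* r) :- a :* (b :* s)) refl

    inverse-close : ∀ {a b r s δ ε} → a * r ≡ 1ℚ → b * s ≡ 1ℚ →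
                    0ℚ < ε → ε ≤ ∣ a ∣ → ε ≤ ∣ b ∣ →
                    ∣ a - b ∣ < δ * (ε * ε) → ∣ r - s ∣ < δ
    inverse-close {a} {b} {r} {s} {δ} {ε} ar≡1 bs≡1 0<ε ε≤a ε≤b p =
      ℚ.*-cancelʳ-<-nonNeg (ε * ε) {{ℚ.nonNegative (ℚ.<⇒≤ (*-pos 0<ε 0<ε))}}
        (ℚ.≤-<-trans step p)
      where
      eq : (r - s) * (a * b) ≡ b - a
      eq = trans (inverse-expand a b r s)
        (cong₂ _-_
          (trans (cong (b *_) ar≡1) (ℚ.*-identityʳ b))
          (trans (cong (a *_) bs≡1) (ℚ.*-identityʳ a)))
      εε≤ : ε * ε ≤ ∣ a * b ∣
      εε≤ = subst (ε * ε ≤_) (sym (ℚ.∣p*q∣≡∣p∣*∣q∣ a b))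
        (ℚ.≤-trans
          (ℚ.*-monoˡ-≤-nonNeg ε {{ℚ.nonNegative (ℚ.<⇒≤ 0<ε)}} ε≤b)
          (ℚ.*-monoʳ-≤-nonNeg ∣ b ∣ {{ℚ.∣-∣-nonNeg b}} ε≤a))
      step : ∣ r - s ∣ * (ε * ε) ≤ ∣ a - b ∣
      step = subst (∣ r - s ∣ * (ε * ε) ≤_)
        (trans (sym (ℚ.∣p*q∣≡∣p∣*∣q∣ (r - s) (a * b)))
          (trans (cong ∣_∣ eq) (∣-∣-sym b a)))
        (ℚ.*-monoˡ-≤-nonNeg ∣ r - s ∣ {{ℚ.∣-∣-nonNeg (r - s)}} εε≤)

    recip-close : ∀ {a b δ ε} → 0ℚ < ε → ε ≤ ∣ a ∣ → ε ≤ ∣ b ∣ →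
                  ∣ a - b ∣ < δ * (ε * ε) → ∣ recipℚ a - recipℚ b ∣ < δ
    recip-close {a} {b} 0<ε ε≤a ε≤b = inverse-close
      (recipℚ-inverse {a} (∣∣-pos⇒≢0 0<ε ε≤a))
      (recipℚ-inverse {b} (∣∣-pos⇒≢0 0<ε ε≤b)) 0<ε ε≤a ε≤b

-- Cantor's real numbers: Cauchy sequences of rationals, with the setoid
-- equality that identifies sequences whose difference tends to 0.
IsCauchy : (ℕ → ℚ) → Set
IsCauchy s = ∀ ε → 0ℚ ℚ.< ε →
  ∃ λ N → ∀ m n → N ℕ.≤ m → N ℕ.≤ n → ℚ.∣ s m ℚ.- s n ∣ ℚ.< ε

record ℝ : Set where
  constructor mkℝ
  field
    seq    : ℕ → ℚ
    cauchy : IsCauchy seq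
open ℝ

infix 4 _≈_ _#_

record _≈_ (x y : ℝ) : Set where
  constructor mk≈
  field
    close : ∀ ε → 0ℚ ℚ.< ε →
      ∃ λ N → ∀ n → N ℕ.≤ n → ℚ.∣ seq x n ℚ.- seq y n ∣ ℚ.< ε
open _≈_

-- Apartness, the positive form of inequality; classically x # y is
-- equivalent to ¬ (x ≈ y).
_#_ : ℝ → ℝ → Set
x # y = ∃ λ ε → 0ℚ ℚ.< ε ∧
  (∃ λ N → ∀ n → N ℕ.≤ n → ε ℚ.≤ ℚ.∣ seq x n ℚ.- seq y n ∣)

private
  ≤ˡ : ∀ {m n k} → m ⊔ n ℕ.≤ k → m ℕ.≤ k
  ≤ˡ {m} {n} = ℕ.m⊔n≤o⇒m≤o m n

  ≤ʳ : ∀ {m n k} → m ⊔ n ℕ.≤ k → n ℕ.≤ k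
  ≤ʳ {m} {n} = ℕ.m⊔n≤o⇒n≤o m n

abstract
  const-cauchy : ∀ q → IsCauchy (λ _ → q)
  const-cauchy q ε 0<ε = 0 , λ _ _ _ _ → ∣-∣-diag q 0<ε

  +-cauchy : ∀ x y → IsCauchy (λ n → seq x n ℚ.+ seq y n)
  +-cauchy x y ε 0<ε =
    let (M , p) = cauchy x (½ ℚ.* ε) (half-pos 0<ε)
        (N , q) = cauchy y (½ ℚ.* ε) (half-pos 0<ε)
    in M ⊔ N , λ m n i j →
      add-close {seq x m} {seq y m} {seq x n} {seq y n} (p m n (≤ˡ i) (≤ˡ j)) (q m n (≤ʳ {M} i) (≤ʳ {M} j))

  neg-cauchy : ∀ x → IsCauchy (λ n → ℚ.- seq x n)
  neg-cauchy x ε 0<ε =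
    let (N , p) = cauchy x ε 0<ε in N , λ m n i j → neg-close {seq x m} {seq x n} (p m n i j)

  eventually-bounded : ∀ x →
    ∃ λ B → 0ℚ ℚ.< B ∧ (∃ λ N → ∀ n → N ℕ.≤ n → ℚ.∣ seq x n ∣ ℚ.< B)
  eventually-bounded x =
    let (N , p) = cauchy x 1ℚ (ℚ.positive⁻¹ 1ℚ)
    in 1ℚ ℚ.+ ℚ.∣ seq x N ∣ , bound-pos (seq x N) , N , λ n i → bound {seq x n} (p n N i ℕ.≤-refl)

  *-cauchy : ∀ x y → IsCauchy (λ n → seq x n ℚ.* seq y n)
  *-cauchy x y ε 0<ε =
    let (A , 0<A , K , a) = eventually-bounded x
        (D , 0<D , L , d) = eventually-bounded y
        (M , p) = cauchy x ((½ ℚ.* ε) ℚ.* recipℚ D) (*-pos (half-pos 0<ε) (recipℚ-pos 0<D))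
        (N , q) = cauchy y ((½ ℚ.* ε) ℚ.* recipℚ A) (*-pos (half-pos 0<ε) (recipℚ-pos 0<A))
    in (K ⊔ L) ⊔ (M ⊔ N) , λ m n i j →
      mul-close {seq x m} {seq y m} {seq x n} {seq y n} 0<A 0<D
        (a m (≤ˡ (≤ˡ i))) (d n (≤ʳ {K} (≤ˡ j)))
        (q m n (≤ʳ {M} (≤ʳ {K ⊔ L} i)) (≤ʳ {M} (≤ʳ {K ⊔ L} j)))
        (p m n (≤ˡ (≤ʳ {K ⊔ L} i)) (≤ˡ (≤ʳ {K ⊔ L} j)))

infixl 6 _+_
infixl 7 _*_
infix  8 -_

fromℚ : ℚ → ℝ
fromℚ q = mkℝ (λ _ → q) (const-cauchy q)

0ℝ 1ℝ : ℝ
0ℝ = fromℚ 0ℚ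
1ℝ = fromℚ 1ℚ

abstract
  recip-cauchy : ∀ x → x # 0ℝ → IsCauchy (λ n → recipℚ (seq x n))
  recip-cauchy x (η , 0<η , M , η≤) ε 0<ε =
    let (N , p) = cauchy x (ε ℚ.* (η ℚ.* η)) (*-pos 0<ε (*-pos 0<η 0<η))
    in M ⊔ N , λ m n i j → recip-close {seq x m} {seq x n} 0<η (η≤′ m (≤ˡ i)) (η≤′ n (≤ˡ j))
                 (p m n (≤ʳ {M} i) (≤ʳ {M} j))
    where
    η≤′ : ∀ n → M ℕ.≤ n → η ℚ.≤ ℚ.∣ seq x n ∣
    η≤′ n i = subst (λ z → η ℚ.≤ ℚ.∣ z ∣) (ℚ.+-identityʳ (seq x n)) (η≤ n i)

opaque
  _+_ _*_ : ℝ → ℝ → ℝ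
  x + y = mkℝ (λ n → seq x n ℚ.+ seq y n) (+-cauchy x y)
  x * y = mkℝ (λ n → seq x n ℚ.* seq y n) (*-cauchy x y)

  -_ : ℝ → ℝ
  - x = mkℝ (λ n → ℚ.- seq x n) (neg-cauchy x)

  inv : (x : ℝ) → x # 0ℝ → ℝ
  inv x x#0 = mkℝ (λ n → recipℚ (seq x n)) (recip-cauchy x x#0)

abstract
  eventually-≡ : ∀ {x y} N → (∀ n → N ℕ.≤ n → seq x n ≡ seq y n) → x ≈ y
  eventually-≡ {x} {y} N eq = mk≈ λ ε 0<ε → N , λ n i →
    subst (λ z → ℚ.∣ seq x n ℚ.- z ∣ ℚ.< ε) (eq n i) (∣-∣-diag (seq x n) 0<ε)

  pointwise : ∀ {x y} → (∀ n → seq x n ≡ seq y n) → x ≈ y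
  pointwise eq = eventually-≡ 0 (λ n _ → eq n)

  ≈-refl : ∀ {x} → x ≈ x
  ≈-refl = pointwise (λ _ → refl)

  ≈-sym : ∀ {x y} → x ≈ y → y ≈ x
  ≈-sym {x} {y} p = mk≈ λ ε 0<ε →
    let (N , h) = close p ε 0<ε
    in N , λ n i → subst (ℚ._< ε) (∣-∣-sym (seq x n) (seq y n)) (h n i)

  ≈-trans : ∀ {x y z} → x ≈ y → y ≈ z → x ≈ z
  ≈-trans {x} {y} {z} p q = mk≈ λ ε 0<ε →
    let (M , g) = close p (½ ℚ.* ε) (half-pos 0<ε)
        (N , h) = close q (½ ℚ.* ε) (half-pos 0<ε)
    in M ⊔ N , λ n i → trans-close {seq x n} {seq y n} {seq z n} (g n (≤ˡ i)) (h n (≤ʳ {M} i))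

opaque
  unfolding _+_ _*_ -_ inv

  +-cong : ∀ {x y u v} → x ≈ y → u ≈ v → x + u ≈ y + v
  +-cong {x} {y} {u} {v} p q = mk≈ λ ε 0<ε →
    let (M , g) = close p (½ ℚ.* ε) (half-pos 0<ε)
        (N , h) = close q (½ ℚ.* ε) (half-pos 0<ε)
    in M ⊔ N , λ n i →
      add-close {seq x n} {seq u n} {seq y n} {seq v n} (g n (≤ˡ i)) (h n (≤ʳ {M} i))

  neg-cong : ∀ {x y} → x ≈ y → - x ≈ - y
  neg-cong {x} {y} p = mk≈ λ ε 0<ε →
    let (N , h) = close p ε 0<ε in N , λ n i → neg-close {seq x n} {seq y n} (h n i)

  *-cong : ∀ {x y u v} → x ≈ y → u ≈ v → x * u ≈ y * v
  *-cong {x} {y} {u} {v} p q = mk≈ λ ε 0<ε →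
    let (A , 0<A , K , a) = eventually-bounded x
        (D , 0<D , L , d) = eventually-bounded v
        (M , g) = close p ((½ ℚ.* ε) ℚ.* recipℚ D) (*-pos (half-pos 0<ε) (recipℚ-pos 0<D))
        (N , h) = close q ((½ ℚ.* ε) ℚ.* recipℚ A) (*-pos (half-pos 0<ε) (recipℚ-pos 0<A))
    in (K ⊔ L) ⊔ (M ⊔ N) , λ n i →
      mul-close {seq x n} {seq u n} {seq y n} {seq v n} 0<A 0<D
        (a n (≤ˡ (≤ˡ i))) (d n (≤ʳ {K} (≤ˡ i)))
        (h n (≤ʳ {M} (≤ʳ {K ⊔ L} i))) (g n (≤ˡ (≤ʳ {K ⊔ L} i)))

  inv-inverseʳ : ∀ x (x#0 : x # 0ℝ) → x * inv x x#0 ≈ 1ℝ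
  inv-inverseʳ x (η , 0<η , N , η≤) = eventually-≡ N λ n i →
    recipℚ-inverse {seq x n} (∣∣-pos⇒≢0 0<η
      (subst (λ z → η ℚ.≤ ℚ.∣ z ∣) (ℚ.+-identityʳ (seq x n)) (η≤ n i)))

  isCommutativeRing : IsCommutativeRing _≈_ _+_ _*_ -_ 0ℝ 1ℝ
  isCommutativeRing = record
    { isRing = record
      { +-isAbelianGroup = record
        { isGroup = record
          { isMonoid = record
            { isSemigroup = record
              { isMagma = record
                { isEquivalence = record { refl = ≈-refl ; sym = ≈-sym ; trans = ≈-trans }
                ; ∙-cong = +-cong }
              ; assoc = λ x y z → pointwise λ n → ℚ.+-assoc (seq x n) (seq y n) (seq z n) }
            ; identity = (λ x → pointwise λ n → ℚ.+-identityˡ (seq x n))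
                       , (λ x → pointwise λ n → ℚ.+-identityʳ (seq x n)) }
          ; inverse = (λ x → pointwise λ n → ℚ.+-inverseˡ (seq x n))
                    , (λ x → pointwise λ n → ℚ.+-inverseʳ (seq x n))
          ; ⁻¹-cong = neg-cong }
        ; comm = λ x y → pointwise λ n → ℚ.+-comm (seq x n) (seq y n) }
      ; *-cong = *-cong
      ; *-assoc = λ x y z → pointwise λ n → ℚ.*-assoc (seq x n) (seq y n) (seq z n)
      ; *-identity = (λ x → pointwise λ n → ℚ.*-identityˡ (seq x n))
                   , (λ x → pointwise λ n → ℚ.*-identityʳ (seq x n))
      ; distrib = (λ x y z → pointwise λ n → ℚ.*-distribˡ-+ (seq x n) (seq y n) (seq z n))
                , (λ x y z → pointwise λ n → ℚ.*-distribʳ-+ (seq x n) (seq y n) (seq z n)) }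
    ; *-comm = λ x y → pointwise λ n → ℚ.*-comm (seq x n) (seq y n) }

  fromℚ-+ : ∀ p q → fromℚ (p ℚ.+ q) ≈ fromℚ p + fromℚ q
  fromℚ-+ p q = pointwise λ _ → refl

  fromℚ-* : ∀ p q → fromℚ (p ℚ.* q) ≈ fromℚ p * fromℚ q
  fromℚ-* p q = pointwise λ _ → refl

ℝ-commutativeRing : CommutativeRing 0ℓ 0ℓ
ℝ-commutativeRing = record { isCommutativeRing = isCommutativeRing }

open CommutativeRing ℝ-commutativeRing public using (_-_)
open RawSemiringDefinitions (Semiring.rawSemiring (CommutativeRing.semiring ℝ-commutativeRing)) public
  using (_×_; _^_; sum)

sumTo : ℕ → (ℕ → ℝ) → ℝ
sumTo n f = sum {suc n} (λ i → f (toℕ i))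

infixl 5 sumTo
syntax sumTo n (λ k → e) = ∑[ k ≤ n ] e

infixl 7 _/!_

_/!_ : ℝ → ℕ → ℝ
z /! k = z * fromℚ ((+ 1 ℚ./ k !) {{k ℕ.!≢0}})

infix 8 _↓[_]_ _↓_

-- y ↓[ μ ] k = (y)_{k,μ} = y (y - μ) ⋯ (y - (k - 1) μ)
_↓[_]_ : ℝ → ℝ → ℕ → ℝ
y ↓[ μ ] zero  = 1ℝ
y ↓[ μ ] suc k = (y ↓[ μ ] k) * (y - k × μ)

_↓_ : ℝ → ℕ → ℝ
y ↓ zero  = 1ℝ
y ↓ suc k = (y ↓ k) * (y - k × 1ℝ)

binom : ℝ → ℕ → ℝ
binom x k = (x ↓ k) /! k

PowerSeries : Set
PowerSeries = ℕ → ℝ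

infix  4 _≋_
infixl 6 _⊝_
infixl 7 _⊛_

_≋_ : PowerSeries → PowerSeries → Set
f ≋ g = ∀ n → f n ≈ g n

𝟙 : PowerSeries
𝟙 zero    = 1ℝ
𝟙 (suc _) = 0ℝ

𝕥 : PowerSeries
𝕥 zero    = 0ℝ
𝕥 (suc n) = 𝟙 n

_⊝_ _⊛_ : PowerSeries → PowerSeries → PowerSeries
(f ⊝ g) n = f n - g n
(f ⊛ g) n = ∑[ k ≤ n ] f k * g (n ∸ k)

-- For f with constant term 1, the coefficients g n , … , g 0 of g = 1 / f,
-- by g 0 = 1 and g (n + 1) = - ∑[ k ≤ n ] f (k + 1) g (n - k).
reciprocalCoeffs : PowerSeries → (n : ℕ) → Vector ℝ (suc n)
reciprocalCoeffs f zero    = λ _ → 1ℝ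
reciprocalCoeffs f (suc n) =
  (- sum (λ i → f (suc (toℕ i)) * reciprocalCoeffs f n i)) ∷ reciprocalCoeffs f n

reciprocal : PowerSeries → PowerSeries
reciprocal f n = reciprocalCoeffs f n Fin.zero

-- degExp ƛ x is the series of e_λ^x(t) = (1 + λ t)^(x/λ).
degExp : ℝ → ℝ → PowerSeries
degExp ƛ x k = (x ↓[ ƛ ] k) /! k

-- t / (e_λ(t) - 1), as the reciprocal of the series (e_λ(t) - 1) / t, whose
-- constant term is (1)_{1,λ} / 1! = 1; see t/[degExp-1]-correct.
t/[degExp-1] : ℝ → PowerSeries
t/[degExp-1] ƛ = reciprocal (λ n → degExp ƛ 1ℝ (suc n))

degBernoulli : ℝ → ℕ → ℝ → ℝ
degBernoulli ƛ n x = (n !) × (t/[degExp-1] ƛ ⊛ degExp ƛ x) n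

-- The identity determines S n k = S_{1,λ}(n,k) for k ≤ n when λ # 0; entries
-- with k > n are irrelevant. degStirling₁-correct shows that such an S exists.
IsDegStirling₁ : ℝ → (ℕ → ℕ → ℝ) → Set
IsDegStirling₁ ƛ S = ∀ n y → y ↓ n ≈ ∑[ k ≤ n ] S n k * (y ↓[ ƛ ] k)

module _ where
  open CommutativeRing ℝ-commutativeRing using (setoid; reflexive; +-identityˡ; +-identityʳ; +-assoc; +-comm; +-congˡ; +-congʳ; *-congˡ; *-congʳ; *-identityˡ; distribʳ; zeroˡ; zeroʳ; -‿inverseʳ; -‿inverseˡ; ring; semiring; +-monoid; +-commutativeMonoid)
  open MonoidSum +-monoid using (sum-cong-≋; sum-init-last)
  open CommutativeMonoidSum +-commutativeMonoid using (∑-distrib-+)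
  open SemiringSum semiring using (*-distribʳ-sum)
  open RingProperties ring using (-0#≈0#)
  open SetoidReasoning setoid

  sumTo-cong : ∀ n f g → (∀ k → f k ≈ g k) → sumTo n f ≈ sumTo n g
  sumTo-cong n f g f≈g = sum-cong-≋ {suc n} λ i → f≈g (toℕ i)

  sumTo-+ : ∀ n f g → ∑[ k ≤ n ] (f k + g k) ≈ sumTo n f + sumTo n g
  sumTo-+ n f g = ∑-distrib-+ {suc n} (λ i → f (toℕ i)) (λ i → g (toℕ i))

  sumTo-*ʳ : ∀ n f c → sumTo n f * c ≈ ∑[ k ≤ n ] f k * c
  sumTo-*ʳ n f c = *-distribʳ-sum {suc n} c (λ i → f (toℕ i))

  reciprocalCoeffs-lookup : ∀ f n (i : Fin (suc n)) →
    reciprocalCoeffs f n i ≡ reciprocal f (n ∸ toℕ i)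
  reciprocalCoeffs-lookup f n       Fin.zero    = refl
  reciprocalCoeffs-lookup f (suc n) (Fin.suc i) = reciprocalCoeffs-lookup f n i

  reciprocal-inverseʳ : ∀ f → f 0 ≈ 1ℝ → f ⊛ reciprocal f ≋ 𝟙
  reciprocal-inverseʳ f f₀ zero = begin
    f 0 * 1ℝ + 0ℝ ≈⟨ +-identityʳ _ ⟩
    f 0 * 1ℝ      ≈⟨ *-congʳ f₀ ⟩
    1ℝ * 1ℝ       ≈⟨ *-identityˡ 1ℝ ⟩
    1ℝ            ∎
  reciprocal-inverseʳ f f₀ (suc n) = begin
    f 0 * - s + sum {suc n} (λ i → f (suc (toℕ i)) * reciprocal f (n ∸ toℕ i))
      ≈⟨ +-cong (≈-trans (*-congʳ f₀) (*-identityˡ _))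
           (sum-cong-≋ {suc n} {λ i → f (suc (toℕ i)) * reciprocal f (n ∸ toℕ i)}
             λ i → reflexive (cong (f (suc (toℕ i)) *_) (sym (reciprocalCoeffs-lookup f n i)))) ⟩
    - s + s
      ≈⟨ -‿inverseˡ s ⟩
    0ℝ ∎
    where
    s : ℝ
    s = sum (λ i → f (suc (toℕ i)) * reciprocalCoeffs f n i)

  x-0≈x : ∀ x → x - 0ℝ ≈ x
  x-0≈x x = ≈-trans (+-congˡ -0#≈0#) (+-identityʳ x)

  degExp₀ : ∀ ƛ x → degExp ƛ x 0 ≈ 1ℝ
  degExp₀ ƛ x = *-identityˡ 1ℝ

  degExp₁ : ∀ ƛ → degExp ƛ 1ℝ 1 ≈ 1ℝ
  degExp₁ ƛ = begin
    (1ℝ * (1ℝ - 0ℝ)) * 1ℝ ≈⟨ *-congʳ (≈-trans (*-identityˡ _) (x-0≈x 1ℝ)) ⟩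
    1ℝ * 1ℝ               ≈⟨ *-identityˡ 1ℝ ⟩
    1ℝ                    ∎

  t/[degExp-1]-correct : ∀ ƛ → (degExp ƛ 1ℝ ⊝ 𝟙) ⊛ t/[degExp-1] ƛ ≋ 𝕥
  t/[degExp-1]-correct ƛ zero = begin
    (degExp ƛ 1ℝ 0 - 1ℝ) * 1ℝ + 0ℝ
      ≈⟨ ≈-trans (+-identityʳ _) (*-congʳ (≈-trans (+-congʳ (degExp₀ ƛ 1ℝ)) (-‿inverseʳ 1ℝ))) ⟩
    0ℝ * 1ℝ
      ≈⟨ zeroˡ 1ℝ ⟩
    0ℝ ∎
  t/[degExp-1]-correct ƛ (suc n) = begin
    (degExp ƛ 1ℝ 0 - 1ℝ) * g (suc n)
      + (∑[ k ≤ n ] (degExp ƛ 1ℝ (suc k) - 0ℝ) * g (n ∸ k))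
      ≈⟨ +-cong
           (≈-trans (*-congʳ (≈-trans (+-congʳ (degExp₀ ƛ 1ℝ)) (-‿inverseʳ 1ℝ))) (zeroˡ _))
           (sumTo-cong n (λ k → (degExp ƛ 1ℝ (suc k) - 0ℝ) * g (n ∸ k))
             (λ k → degExp ƛ 1ℝ (suc k) * g (n ∸ k)) λ k → *-congʳ (x-0≈x _)) ⟩
    0ℝ + ((λ m → degExp ƛ 1ℝ (suc m)) ⊛ g) n
      ≈⟨ +-identityˡ _ ⟩
    ((λ m → degExp ƛ 1ℝ (suc m)) ⊛ g) n
      ≈⟨ reciprocal-inverseʳ _ (degExp₁ ƛ) n ⟩
    𝟙 n ∎
    where
    g : PowerSeries
    g = t/[degExp-1] ƛ

  degStirling₁ : ℝ → ℕ → ℕ → ℝ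
  degStirling₁ ƛ zero    zero    = 1ℝ
  degStirling₁ ƛ zero    (suc k) = 0ℝ
  degStirling₁ ƛ (suc n) zero    = (0 × ƛ - n × 1ℝ) * degStirling₁ ƛ n 0
  degStirling₁ ƛ (suc n) (suc k) =
    degStirling₁ ƛ n k + (suc k × ƛ - n × 1ℝ) * degStirling₁ ƛ n (suc k)

  degStirling₁-zero : ∀ ƛ n k → n ℕ.< k → degStirling₁ ƛ n k ≈ 0ℝ
  degStirling₁-zero ƛ zero    (suc k) _           = ≈-refl
  degStirling₁-zero ƛ (suc n) (suc k) (ℕ.s≤s n<k) = begin
    degStirling₁ ƛ n k + _ * degStirling₁ ƛ n (suc k)
      ≈⟨ +-cong (degStirling₁-zero ƛ n k n<k)
           (*-congˡ (degStirling₁-zero ƛ n (suc k) (ℕ.m≤n⇒m≤1+n n<k))) ⟩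
    0ℝ + _ * 0ℝ
      ≈⟨ ≈-trans (+-identityˡ _) (zeroʳ _) ⟩
    0ℝ ∎

  sumTo-last : ∀ n f → f (suc n) ≈ 0ℝ → sumTo (suc n) f ≈ sumTo n f
  sumTo-last n f fₙ = begin
    sumTo (suc n) f
      ≈⟨ sum-init-last {suc n} (λ i → f (toℕ i)) ⟩
    sum {suc n} (λ i → f (toℕ (inject₁ i))) + f (toℕ (fromℕ (suc n)))
      ≈⟨ +-cong
           (sum-cong-≋ {suc n} {λ i → f (toℕ (inject₁ i))} λ i → reflexive (cong f (Fin.toℕ-inject₁ i)))
           (≈-trans (reflexive (cong f (Fin.toℕ-fromℕ (suc n)))) fₙ) ⟩
    sumTo n f + 0ℝ
      ≈⟨ +-identityʳ _ ⟩
    sumTo n f ∎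

  opaque
    unfolding _+_ _*_ -_

    merge : ∀ y s q a b → s * (q * (y - a)) + ((a - b) * s) * q ≈ (s * q) * (y - b)
    merge y s q a b = pointwise λ m →
      solve 5 (λ s q y a b → s :* (q :* (y :- a)) :+ ((a :- b) :* s) :* q
                             := (s :* q) :* (y :- b))
        refl (seq s m) (seq q m) (seq y m) (seq a m) (seq b m)
      where open ℚSolver.+-*-Solver

  degStirling₁-correct : ∀ ƛ → IsDegStirling₁ ƛ (degStirling₁ ƛ)
  degStirling₁-correct ƛ zero    y =
    ≈-sym (≈-trans (+-identityʳ _) (*-identityˡ 1ℝ))
  degStirling₁-correct ƛ (suc n) y = ≈-sym (begin
    (c 0 * S n 0) * p 0 + (∑[ k ≤ n ] (S n k + c (suc k) * S n (suc k)) * p (suc k))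
      ≈⟨ +-congˡ (sumTo-cong n _ (λ k → v k + u (suc k)) λ k → distribʳ _ _ _) ⟩
    u 0 + (∑[ k ≤ n ] (v k + u (suc k)))
      ≈⟨ +-congˡ (sumTo-+ n v (λ k → u (suc k))) ⟩
    u 0 + (sumTo n v + (∑[ k ≤ n ] u (suc k)))
      ≈⟨ ≈-trans (≈-sym (+-assoc _ _ _)) (≈-trans (+-congʳ (+-comm _ _)) (+-assoc _ _ _)) ⟩
    sumTo n v + sumTo (suc n) u
      ≈⟨ +-congˡ (sumTo-last n u uₙ₊₁≈0) ⟩
    sumTo n v + sumTo n u
      ≈⟨ sumTo-+ n v u ⟨
    ∑[ k ≤ n ] (v k + u k)
      ≈⟨ sumTo-cong n _ _ (λ k → merge y (S n k) (p k) (k × ƛ) (n × 1ℝ)) ⟩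
    ∑[ k ≤ n ] (S n k * p k) * (y - n × 1ℝ)
      ≈⟨ sumTo-*ʳ n (λ k → S n k * p k) (y - n × 1ℝ) ⟨
    (∑[ k ≤ n ] S n k * p k) * (y - n × 1ℝ)
      ≈⟨ *-congʳ (degStirling₁-correct ƛ n y) ⟨
    (y ↓ n) * (y - n × 1ℝ) ∎)
    where
    S : ℕ → ℕ → ℝ
    S = degStirling₁ ƛ
    p c u v : ℕ → ℝ
    p k = y ↓[ ƛ ] k
    c k = k × ƛ - n × 1ℝ
    u k = (c k * S n k) * p k
    v k = S n k * p (suc k)
    uₙ₊₁≈0 : u (suc n) ≈ 0ℝ
    uₙ₊₁≈0 = begin
      (c (suc n) * S n (suc n)) * p (suc n)
        ≈⟨ *-congʳ (*-congˡ (degStirling₁-zero ƛ n (suc n) ℕ.≤-refl)) ⟩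
      (c (suc n) * 0ℝ) * p (suc n)
        ≈⟨ *-congʳ (zeroʳ _) ⟩
      0ℝ * p (suc n)
        ≈⟨ zeroˡ _ ⟩
      0ℝ ∎

{-# OPTIONS --safe #-}

-- Write e_k(y) = (y)_{k,λ} / k! and let L be the linear functional on polynomials in y
-- with L(e_k) = β_{k,λ}(x) / k!, so that the left-hand side is L((y)_n). Vandermonde's
-- convolution gives e_{k+1}(1 + y) - e_{k+1}(y) = ∑_{j ≤ k} e_{j+1}(1) e_{k-j}(y), and the
-- series ∑ e_{j+1}(1) t^j is the inverse of t / (e_λ(t) - 1), so L(p(1 + y) - p(y)) takes
-- e_{k+1} to e_k(x). The difference with step λ satisfies
-- e_{k+1}(λ + x) - e_{k+1}(x) = λ e_k(x), hence λ L(p(1 + y) - p(y)) = p(λ + x) - p(x) for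
-- every p. For p(y) = binom(y, n + 1) the left-hand side is λ L(binom(y, n)), while
-- Vandermonde expands the right-hand side into the sum of the theorem.
module Submission where

open import Defs
open import Data.Nat.Base using (ℕ; _∸_; _!) renaming (_+_ to _+ℕ_)

open import Algebra.Bundles using (CommutativeRing)
import Algebra.Properties.CommutativeMonoid.Mult as CommutativeMonoidMult
import Algebra.Properties.Monoid.Mult as MonoidMult
import Algebra.Properties.Monoid.Sum as MonoidSum
import Algebra.Properties.Ring as RingProperties
import Algebra.Properties.Semiring.Mult as SemiringMult
import Algebra.Properties.Semiring.Sum as SemiringSum
import Algebra.Solver.Ring.NaturalCoefficients.Default as SemiringSolver
open import Data.Fin.Base using (toℕ)
open import Data.Fin.Properties using (toℕ<n)
open import Data.Integer.Base using (ℤ; +_; 1ℤ) renaming (_+_ to _+ℤ_; _*_ to _*ℤ_)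
import Data.Integer.Properties as ℤ
import Data.Integer.Tactic.RingSolver as ℤSolver
open import Data.Nat.Base using (zero; suc; _≤_; s≤s; s≤s⁻¹; NonZero)
import Data.Nat.Base as ℕ
import Data.Nat.Properties as ℕ
import Data.Rational.Base as ℚ
import Data.Rational.Properties as ℚ
open import Data.Rational.Unnormalised.Base as ℚᵘ using (mkℚᵘ; *≡*)
import Data.Rational.Unnormalised.Properties as ℚᵘ
open import Function.Base using (_∘_)
open import Relation.Binary.PropositionalEquality as ≡ using (_≡_; refl; cong)
import Relation.Binary.Reasoning.Setoid as SetoidReasoning

open CommutativeRing ℝ-commutativeRing using (setoid; reflexive; ring; semiring; commutativeSemiring; +-monoid; +-commutativeMonoid; +-identityˡ; +-identityʳ; +-assoc; +-comm; +-congˡ; +-congʳ; -‿cong; -‿inverseʳ; *-congˡ; *-congʳ; *-assoc; *-comm; *-identityˡ; *-identityʳ; distribˡ; zeroˡ; zeroʳ)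
open CommutativeMonoidMult +-commutativeMonoid using (×-distrib-+)
open MonoidMult +-monoid using (×-congʳ; ×-congˡ; ×-homo-+; ×-homo-1; ×-assocˡ)
open MonoidSum +-monoid using (sum-cong-≋)
open RingProperties ring using (-‿distribʳ-*; -‿+-comm; -0#≈0#)
open SemiringMult semiring using (×-comm-*; ×-assoc-*)
open SemiringSum semiring using (*-distribˡ-sum)
open SemiringSolver commutativeSemiring using (solve; _:=_; _:+_; _:*_)
open SetoidReasoning setoid

-- Factorials

-- Fractions in `ℚ` are normalised by a gcd, which blocks computation for variable `m` and `d`.
-- Passing to unnormalised rationals leaves the integer identity `common-denominator`.
[1+m]/d : ∀ m d → (+ 1 ℚ./ suc d) ℚ.+ (+ m ℚ./ suc d) ≡ + suc m ℚ./ suc d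
[1+m]/d m d = ℚ.toℚᵘ-injective (ℚᵘ.≃-trans
  (ℚ.toℚᵘ-homo-+ (+ 1 ℚ./ suc d) (+ m ℚ./ suc d))
  (ℚᵘ.≃-trans
    (ℚᵘ.+-cong (ℚ.toℚᵘ-fromℚᵘ (mkℚᵘ (+ 1) d)) (ℚ.toℚᵘ-fromℚᵘ (mkℚᵘ (+ m) d)))
    (ℚᵘ.≃-trans (*≡* (common-denominator (+ m) (+ suc d)))
      (ℚᵘ.≃-sym (ℚ.toℚᵘ-fromℚᵘ (mkℚᵘ (+ suc m) d))))))
  where
  common-denominator : ∀ (m d : ℤ) →
    (1ℤ *ℤ d +ℤ m *ℤ d) *ℤ d ≡ (1ℤ +ℤ m) *ℤ (d *ℤ d)
  common-denominator = ℤSolver.solve-∀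

×-fromℚ : ∀ m d → m × fromℚ (+ 1 ℚ./ suc d) ≈ fromℚ (+ m ℚ./ suc d)
×-fromℚ zero    d = reflexive (cong fromℚ (≡.sym (ℚ.0/n≡0 (suc d))))
×-fromℚ (suc m) d = begin
  fromℚ (+ 1 ℚ./ suc d) + m × fromℚ (+ 1 ℚ./ suc d) ≈⟨ +-congˡ (×-fromℚ m d) ⟩
  fromℚ (+ 1 ℚ./ suc d) + fromℚ (+ m ℚ./ suc d)     ≈⟨ fromℚ-+ _ _ ⟨
  fromℚ ((+ 1 ℚ./ suc d) ℚ.+ (+ m ℚ./ suc d))       ≡⟨ cong fromℚ ([1+m]/d m d) ⟩
  fromℚ (+ suc m ℚ./ suc d)                         ∎

n×1/n≈1 : ∀ n .{{_ : NonZero n}} → n × fromℚ (+ 1 ℚ./ n) ≈ 1ℝ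
n×1/n≈1 (suc n) = ≈-trans (×-fromℚ (suc n) n)
  (reflexive (cong fromℚ (ℚ.fromℚᵘ-cong {mkℚᵘ (+ suc n) n} {ℚᵘ.1ℚᵘ}
    (*≡* (ℤ.*-comm (+ suc n) (+ 1))))))

×-cancel : ∀ n {x y} → suc n × x ≈ suc n × y → x ≈ y
×-cancel n {x} {y} eq = begin
  x                ≈⟨ scale x ⟨
  r * (suc n × x)  ≈⟨ *-congˡ eq ⟩
  r * (suc n × y)  ≈⟨ scale y ⟩
  y                ∎
  where
  r : ℝ
  r = fromℚ (+ 1 ℚ./ suc n)
  scale : ∀ z → r * (suc n × z) ≈ z
  scale z = begin
    r * (suc n × z) ≈⟨ ×-comm-* (suc n) r z ⟩
    suc n × (r * z) ≈⟨ ×-assoc-* (suc n) r z ⟨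
    (suc n × r) * z ≈⟨ *-congʳ (n×1/n≈1 (suc n)) ⟩
    1ℝ * z          ≈⟨ *-identityˡ z ⟩
    z               ∎

/!-cong : ∀ k {x y} → x ≈ y → x /! k ≈ y /! k
/!-cong k = *-congʳ

!×/! : ∀ k x → (k !) × (x /! k) ≈ x
!×/! k x = begin
  (k !) × (x /! k)    ≈⟨ ×-comm-* (k !) x _ ⟨
  x * ((k !) × _)     ≈⟨ *-congˡ (n×1/n≈1 (k !) {{k ℕ.!≢0}}) ⟩
  x * 1ℝ              ≈⟨ *-identityʳ x ⟩
  x                   ∎

×!-cancel : ∀ k {x y} → (k !) × x ≈ (k !) × y → x ≈ y
×!-cancel k {x} {y} eq = cancel (k !) {{k ℕ.!≢0}} eq
  where
  -- `k !` does not reduce to a successor, so it is generalised to a variable that can be matched.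
  cancel : ∀ n .{{_ : NonZero n}} → n × x ≈ n × y → x ≈ y
  cancel (suc n) = ×-cancel n

-- Multiplied by `k !`, both sides become `x`. This is how a derivative absorbs one factor of a
-- factorial denominator.
suc×/! : ∀ k x → suc k × (x /! suc k) ≈ x /! k
suc×/! k x = ×!-cancel k (begin
  (k !) × (suc k × (x /! suc k))  ≈⟨ ×-assocˡ _ (k !) (suc k) ⟩
  (k ! ℕ.* suc k) × (x /! suc k)  ≡⟨ cong (_× (x /! suc k)) (ℕ.*-comm (k !) (suc k)) ⟩
  (suc k !) × (x /! suc k)        ≈⟨ !×/! (suc k) x ⟩
  x                               ≈⟨ !×/! k x ⟨
  (k !) × (x /! k)                ∎)

-- Finite sums

-- The bound `k ≤ n` is passed to the hypothesis because identities such as k + (n ∸ k) = n depend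
-- on it.
sumTo-cong-≤ : ∀ n {f g} → (∀ k → k ≤ n → f k ≈ g k) → sumTo n f ≈ sumTo n g
sumTo-cong-≤ n {f} {g} f≈g =
  sum-cong-≋ {suc n} {λ i → f (toℕ i)} {λ i → g (toℕ i)} λ i → f≈g (toℕ i) (s≤s⁻¹ (toℕ<n i))

sumTo-*ˡ : ∀ n c f → c * sumTo n f ≈ ∑[ k ≤ n ] c * f k
sumTo-*ˡ n c f = *-distribˡ-sum {suc n} c (λ i → f (toℕ i))

sumTo-*-congˡ : ∀ n (a : ℕ → ℝ) {u v : ℕ → ℝ} → (∀ k → u k ≈ v k) →
  ∑[ k ≤ n ] a k * u k ≈ ∑[ k ≤ n ] a k * v k
sumTo-*-congˡ n a {u} {v} u≈v =
  sumTo-cong n (λ k → a k * u k) (λ k → a k * v k) λ k → *-congˡ (u≈v k)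

sumTo-× : ∀ n m f → m × sumTo n f ≈ ∑[ k ≤ n ] (m × f k)
sumTo-× zero    m f = ≈-trans (×-congʳ m (+-identityʳ _)) (≈-sym (+-identityʳ _))
sumTo-× (suc n) m f = ≈-trans (×-distrib-+ _ _ m) (+-congˡ (sumTo-× n m (f ∘ suc)))

sumTo-0 : ∀ n {f} → (∀ k → f k ≈ 0ℝ) → sumTo n f ≈ 0ℝ
sumTo-0 zero    f≈0 = ≈-trans (+-identityʳ _) (f≈0 0)
sumTo-0 (suc n) f≈0 =
  ≈-trans (+-cong (f≈0 0) (sumTo-0 n (f≈0 ∘ suc))) (+-identityˡ 0ℝ)

sumTo-neg : ∀ n f → - sumTo n f ≈ ∑[ k ≤ n ] (- f k)
sumTo-neg zero    f = ≈-trans (≈-sym (-‿+-comm _ _)) (+-congˡ -0#≈0#)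
sumTo-neg (suc n) f = ≈-trans (≈-sym (-‿+-comm _ _)) (+-congˡ (sumTo-neg n (f ∘ suc)))

[x+y]-[x+z]≈y-z : ∀ x y z → (x + y) - (x + z) ≈ y - z
[x+y]-[x+z]≈y-z x y z = begin
  (x + y) + - (x + z)     ≈⟨ +-congˡ (-‿+-comm x z) ⟨
  (x + y) + (- x + - z)   ≈⟨ solve 4 (λ x y -x -z → (x :+ y) :+ (-x :+ -z) := (x :+ -x) :+ (y :+ -z)) ≈-refl x y (- x) (- z) ⟩
  (x - x) + (y - z)       ≈⟨ +-congʳ (-‿inverseʳ x) ⟩
  0ℝ + (y - z)            ≈⟨ +-identityˡ _ ⟩
  y - z                   ∎

*-distribˡ-- : ∀ x y z → x * (y - z) ≈ x * y - x * z
*-distribˡ-- x y z = ≈-trans (distribˡ x y (- z)) (+-congˡ (≈-sym (-‿distribʳ-* x z)))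

-- The terms of index 0 cancel, so a difference of two expansions drops its constant term and the
-- remaining indices start at 1.
sumTo-difference : ∀ n (a u v : ℕ → ℝ) → u 0 ≈ v 0 →
  (∑[ k ≤ suc n ] a k * u k) - (∑[ k ≤ suc n ] a k * v k)
    ≈ ∑[ k ≤ n ] a (suc k) * (u (suc k) - v (suc k))
sumTo-difference n a u v u₀≈v₀ = begin
  (a 0 * u 0 + sumTo n p) - (a 0 * v 0 + sumTo n q)
    ≈⟨ +-congʳ (+-congʳ (*-congˡ u₀≈v₀)) ⟩
  (a 0 * v 0 + sumTo n p) - (a 0 * v 0 + sumTo n q)
    ≈⟨ [x+y]-[x+z]≈y-z _ _ _ ⟩
  sumTo n p - sumTo n q
    ≈⟨ +-congˡ (sumTo-neg n q) ⟩
  sumTo n p + (∑[ k ≤ n ] (- q k))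
    ≈⟨ sumTo-+ n p (λ k → - q k) ⟨
  ∑[ k ≤ n ] (p k - q k)
    ≈⟨ sumTo-cong n _ (λ k → a (suc k) * (u (suc k) - v (suc k))) (λ k → ≈-sym (*-distribˡ-- (a (suc k)) (u (suc k)) (v (suc k)))) ⟩
  ∑[ k ≤ n ] a (suc k) * (u (suc k) - v (suc k)) ∎
  where
  p q : ℕ → ℝ
  p k = a (suc k) * u (suc k)
  q k = a (suc k) * v (suc k)

-- The Cauchy product

⊛-congʳ : ∀ {f g} h → f ≋ g → f ⊛ h ≋ g ⊛ h
⊛-congʳ {f} {g} h f≋g n =
  sumTo-cong n (λ k → f k * h (n ∸ k)) (λ k → g k * h (n ∸ k)) λ k → *-congʳ (f≋g k)

-- By definition a product of degree `suc n` splits off its term with `f 0`; this splits off the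
-- term at the other end, with `g 0`.
⊛-suc : ∀ f g n → (f ⊛ g) (suc n) ≈ (f ⊛ (g ∘ suc)) n + f (suc n) * g 0
⊛-suc f g zero    =
  ≈-trans (+-congˡ (+-identityʳ _)) (+-congʳ (≈-sym (+-identityʳ _)))
⊛-suc f g (suc n) = ≈-trans (+-congˡ (⊛-suc (f ∘ suc) g n)) (≈-sym (+-assoc _ _ _))

⊛-comm : ∀ f g → f ⊛ g ≋ g ⊛ f
⊛-comm f g zero    = +-congʳ (*-comm _ _)
⊛-comm f g (suc n) = begin
  f 0 * g (suc n) + ((f ∘ suc) ⊛ g) n ≈⟨ +-comm _ _ ⟩
  ((f ∘ suc) ⊛ g) n + f 0 * g (suc n) ≈⟨ +-cong (⊛-comm (f ∘ suc) g n) (*-comm _ _) ⟩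
  (g ⊛ (f ∘ suc)) n + g (suc n) * f 0 ≈⟨ ⊛-suc g f n ⟨
  (g ⊛ f) (suc n)                     ∎

-- Induction on the degree for all `f` at once: removing the terms with `f 0` leaves the same claim
-- for the shifted series `f ∘ suc`.
⊛-assoc : ∀ f g h → (f ⊛ g) ⊛ h ≋ f ⊛ (g ⊛ h)
⊛-assoc f g h zero    =
  +-congʳ (≈-trans (*-congʳ (+-identityʳ _)) (≈-trans (*-assoc _ _ _) (*-congˡ (≈-sym (+-identityʳ _)))))
⊛-assoc f g h (suc n) = begin
  (f ⊛ g) 0 * h (suc n) + (((f ⊛ g) ∘ suc) ⊛ h) n
    ≈⟨ +-cong (*-congʳ (+-identityʳ _)) split ⟩
  (f 0 * g 0) * h (suc n) + (f 0 * ((g ∘ suc) ⊛ h) n + (((f ∘ suc) ⊛ g) ⊛ h) n)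
    ≈⟨ +-congˡ (+-congˡ (⊛-assoc (f ∘ suc) g h n)) ⟩
  (f 0 * g 0) * h (suc n) + (f 0 * ((g ∘ suc) ⊛ h) n + ((f ∘ suc) ⊛ (g ⊛ h)) n)
    ≈⟨ solve 5 (λ a b c d e → (a :* b) :* c :+ (a :* d :+ e) := a :* (b :* c :+ d) :+ e) ≈-refl
         (f 0) (g 0) (h (suc n)) (((g ∘ suc) ⊛ h) n) (((f ∘ suc) ⊛ (g ⊛ h)) n) ⟩
  f 0 * (g ⊛ h) (suc n) + ((f ∘ suc) ⊛ (g ⊛ h)) n ∎
  where
  split : (((f ⊛ g) ∘ suc) ⊛ h) n ≈ f 0 * ((g ∘ suc) ⊛ h) n + (((f ∘ suc) ⊛ g) ⊛ h) n
  split = begin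
    ∑[ k ≤ n ] (f 0 * g (suc k) + ((f ∘ suc) ⊛ g) k) * h (n ∸ k)
      ≈⟨ sumTo-cong n _ (λ k → f 0 * (g (suc k) * h (n ∸ k)) + ((f ∘ suc) ⊛ g) k * h (n ∸ k))
           (λ k → solve 4 (λ a b c d → (a :* b :+ c) :* d := a :* (b :* d) :+ c :* d) ≈-refl
             (f 0) (g (suc k)) (((f ∘ suc) ⊛ g) k) (h (n ∸ k))) ⟩
    ∑[ k ≤ n ] (f 0 * (g (suc k) * h (n ∸ k)) + ((f ∘ suc) ⊛ g) k * h (n ∸ k))
      ≈⟨ sumTo-+ n (λ k → f 0 * (g (suc k) * h (n ∸ k))) (λ k → ((f ∘ suc) ⊛ g) k * h (n ∸ k)) ⟩
    (∑[ k ≤ n ] f 0 * (g (suc k) * h (n ∸ k))) + (((f ∘ suc) ⊛ g) ⊛ h) n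
      ≈⟨ +-congʳ (sumTo-*ˡ n (f 0) (λ k → g (suc k) * h (n ∸ k))) ⟨
    f 0 * ((g ∘ suc) ⊛ h) n + (((f ∘ suc) ⊛ g) ⊛ h) n ∎

⊛-constantˡ : ∀ f g → (∀ k → f (suc k) ≈ 0ℝ) → ∀ n → (f ⊛ g) n ≈ f 0 * g n
⊛-constantˡ f g f≈0 zero    = +-identityʳ _
⊛-constantˡ f g f≈0 (suc n) = ≈-trans
  (+-congˡ (sumTo-0 n λ k → ≈-trans (*-congʳ (f≈0 k)) (zeroˡ (g (n ∸ k)))))
  (+-identityʳ _)

-- Formal differentiation of power series

derivative : PowerSeries → PowerSeries
derivative f n = suc n × f (suc n)

×-split : ∀ n k f g → k ≤ n → n × (f * g) ≈ (k × f) * g + f * ((n ∸ k) × g)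
×-split n k f g k≤n = begin
  n × (f * g)                         ≡⟨ cong (_× (f * g)) (ℕ.m+[n∸m]≡n k≤n) ⟨
  (k +ℕ (n ∸ k)) × (f * g)            ≈⟨ ×-homo-+ (f * g) k (n ∸ k) ⟩
  k × (f * g) + (n ∸ k) × (f * g)     ≈⟨ +-cong (×-assoc-* k f g) (×-comm-* (n ∸ k) f g) ⟨
  (k × f) * g + f * ((n ∸ k) × g)     ∎

leibniz : ∀ f g n → derivative (f ⊛ g) n ≈ (derivative f ⊛ g) n + (f ⊛ derivative g) n
leibniz f g n = begin
  suc n × (f ⊛ g) (suc n)
    ≈⟨ sumTo-× (suc n) (suc n) (λ k → f k * g (suc n ∸ k)) ⟩
  ∑[ k ≤ suc n ] (suc n × (f k * g (suc n ∸ k)))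
    ≈⟨ sumTo-cong-≤ (suc n) (λ k → ×-split (suc n) k (f k) (g (suc n ∸ k))) ⟩
  ∑[ k ≤ suc n ] ((k × f k) * g (suc n ∸ k) + f k * ((suc n ∸ k) × g (suc n ∸ k)))
    ≈⟨ sumTo-+ (suc n) (λ k → (k × f k) * g (suc n ∸ k)) (λ k → f k * ((suc n ∸ k) × g (suc n ∸ k))) ⟩
  ((λ k → k × f k) ⊛ g) (suc n) + (f ⊛ (λ k → k × g k)) (suc n)
    -- The weight is 0 at the first term of the left product and at the last term of the right one.
    -- Dropping these terms shifts the indices and produces the two derivatives.
    ≈⟨ +-cong
         (≈-trans (+-congʳ (zeroˡ _)) (+-identityˡ _))
         (≈-trans (⊛-suc f (λ k → k × g k) n) (≈-trans (+-congˡ (zeroʳ _)) (+-identityʳ _))) ⟩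
  (derivative f ⊛ g) n + (f ⊛ derivative g) n ∎

-- The transpose of multiplication by a power series

adjoint : ℕ → PowerSeries → (ℕ → ℝ) → ℕ → ℝ
adjoint n f a j = ∑[ k ≤ n ∸ j ] a (j +ℕ k) * f k

-- An interchange of summation over j ≤ k ≤ n: `adjoint n f` is the transpose of the truncated map
-- sending `w` to `f ⊛ w`. Each step collects the multiples of `w 0` into the entry j = 0 and leaves
-- the same claim for the shifted `a` and `w`.
adjoint-correct : ∀ n f a w →
  ∑[ k ≤ n ] a k * (f ⊛ w) k ≈ ∑[ j ≤ n ] adjoint n f a j * w j
adjoint-correct zero    f a w =
  +-congʳ (≈-trans (*-congˡ (+-identityʳ _)) (≈-trans (≈-sym (*-assoc _ _ _)) (*-congʳ (≈-sym (+-identityʳ _)))))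
adjoint-correct (suc n) f a w = begin
  a 0 * (f ⊛ w) 0 + (∑[ k ≤ n ] a (suc k) * (f ⊛ w) (suc k))
    ≈⟨ +-cong (≈-trans (*-congˡ (+-identityʳ _)) (≈-sym (*-assoc _ _ _))) split ⟩
  (a 0 * f 0) * w 0 + ((∑[ k ≤ n ] a (suc k) * f (suc k)) * w 0 + (∑[ k ≤ n ] a (suc k) * (f ⊛ (w ∘ suc)) k))
    ≈⟨ solve 4 (λ a b w c → a :* w :+ (b :* w :+ c) := (a :+ b) :* w :+ c) ≈-refl
         (a 0 * f 0) (∑[ k ≤ n ] a (suc k) * f (suc k)) (w 0) _ ⟩
  adjoint (suc n) f a 0 * w 0 + (∑[ k ≤ n ] a (suc k) * (f ⊛ (w ∘ suc)) k)
    ≈⟨ +-congˡ (adjoint-correct n f (a ∘ suc) (w ∘ suc)) ⟩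
  ∑[ j ≤ suc n ] adjoint (suc n) f a j * w j ∎
  where
  split : ∑[ k ≤ n ] a (suc k) * (f ⊛ w) (suc k)
    ≈ (∑[ k ≤ n ] a (suc k) * f (suc k)) * w 0 + (∑[ k ≤ n ] a (suc k) * (f ⊛ (w ∘ suc)) k)
  split = begin
    ∑[ k ≤ n ] a (suc k) * (f ⊛ w) (suc k)
      ≈⟨ sumTo-cong n _ _ (λ k → ≈-trans (*-congˡ (⊛-suc f w k))
           (solve 4 (λ a x f w → a :* (x :+ f :* w) := (a :* f) :* w :+ a :* x) ≈-refl
             (a (suc k)) ((f ⊛ (w ∘ suc)) k) (f (suc k)) (w 0))) ⟩
    ∑[ k ≤ n ] ((a (suc k) * f (suc k)) * w 0 + a (suc k) * (f ⊛ (w ∘ suc)) k)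
      ≈⟨ sumTo-+ n (λ k → (a (suc k) * f (suc k)) * w 0) (λ k → a (suc k) * (f ⊛ (w ∘ suc)) k) ⟩
    (∑[ k ≤ n ] (a (suc k) * f (suc k)) * w 0) + (∑[ k ≤ n ] a (suc k) * (f ⊛ (w ∘ suc)) k)
      ≈⟨ +-congʳ (sumTo-*ʳ n (λ k → a (suc k) * f (suc k)) (w 0)) ⟨
    (∑[ k ≤ n ] a (suc k) * f (suc k)) * w 0 + (∑[ k ≤ n ] a (suc k) * (f ⊛ (w ∘ suc)) k) ∎

-- The degenerate exponential

-- For F = e_μ^y(t) this is the differential equation (1 + μt) F' = y F, read off coefficientwise.
degExp-derivative : ∀ μ y k → derivative (degExp μ y) k ≈ (y - k × μ) * degExp μ y k
degExp-derivative μ y k = begin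
  suc k × (((y ↓[ μ ] k) * (y - k × μ)) /! suc k)  ≈⟨ suc×/! k _ ⟩
  ((y ↓[ μ ] k) * (y - k × μ)) /! k                ≈⟨ *-congʳ (*-comm _ _) ⟩
  ((y - k × μ) * (y ↓[ μ ] k)) /! k                ≈⟨ *-assoc _ _ _ ⟩
  (y - k × μ) * degExp μ y k                       ∎

-- Vandermonde's convolution. By `leibniz` the product satisfies the recurrence of
-- `degExp-derivative` for `x + y`, and both constant terms are 1; induction on the degree then
-- cancels the factor `suc n`.
degExp-+ : ∀ μ x y → degExp μ (x + y) ≋ degExp μ x ⊛ degExp μ y
degExp-+ μ x y zero    = ≈-trans (degExp₀ μ (x + y)) (≈-sym (≈-trans (+-identityʳ _)
  (≈-trans (*-cong (degExp₀ μ x) (degExp₀ μ y)) (*-identityˡ 1ℝ))))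
degExp-+ μ x y (suc n) = ×-cancel n (begin
  derivative (degExp μ (x + y)) n
    ≈⟨ degExp-derivative μ (x + y) n ⟩
  ((x + y) - n × μ) * degExp μ (x + y) n
    ≈⟨ *-congˡ (degExp-+ μ x y n) ⟩
  ((x + y) - n × μ) * (f ⊛ g) n
    ≈⟨ sumTo-*ˡ n _ (λ k → f k * g (n ∸ k)) ⟩
  ∑[ k ≤ n ] ((x + y) - n × μ) * (f k * g (n ∸ k))
    ≈⟨ sumTo-cong-≤ n split ⟩
  ∑[ k ≤ n ] (derivative f k * g (n ∸ k) + f k * derivative g (n ∸ k))
    ≈⟨ sumTo-+ n (λ k → derivative f k * g (n ∸ k)) (λ k → f k * derivative g (n ∸ k)) ⟩
  (derivative f ⊛ g) n + (f ⊛ derivative g) n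
    ≈⟨ leibniz f g n ⟨
  derivative (f ⊛ g) n ∎)
  where
  f g : PowerSeries
  f = degExp μ x
  g = degExp μ y
  split : ∀ k → k ≤ n → ((x + y) - n × μ) * (f k * g (n ∸ k))
    ≈ derivative f k * g (n ∸ k) + f k * derivative g (n ∸ k)
  split k k≤n = begin
    ((x + y) + - (n × μ)) * (f k * g (n ∸ k))
      -- The scalar becomes (x - kμ) + (y - (n - k)μ), one summand for each factor of the product.
      ≈⟨ *-congʳ (+-congˡ (≈-trans
           (-‿cong (≈-trans (×-congˡ {μ} (≡.sym (ℕ.m+[n∸m]≡n k≤n))) (×-homo-+ μ k (n ∸ k))))
           (≈-sym (-‿+-comm _ _)))) ⟩
    ((x + y) + (- (k × μ) + - ((n ∸ k) × μ))) * (f k * g (n ∸ k))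
      ≈⟨ solve 6 (λ x y a b f g → ((x :+ y) :+ (a :+ b)) :* (f :* g)
           := ((x :+ a) :* f) :* g :+ f :* ((y :+ b) :* g)) ≈-refl
           x y (- (k × μ)) (- ((n ∸ k) × μ)) (f k) (g (n ∸ k)) ⟩
    ((x - k × μ) * f k) * g (n ∸ k) + f k * ((y - (n ∸ k) × μ) * g (n ∸ k))
      ≈⟨ +-cong (*-congʳ (degExp-derivative μ x k)) (*-congˡ (degExp-derivative μ y (n ∸ k))) ⟨
    derivative f k * g (n ∸ k) + f k * derivative g (n ∸ k) ∎

-- The first term of Vandermonde's convolution is the coefficient at `y` itself, since `degExp μ x`
-- has constant term 1; the subtraction removes exactly that term.
degExp-difference : ∀ μ x y n →
  degExp μ (x + y) (suc n) - degExp μ y (suc n) ≈ ((degExp μ x ∘ suc) ⊛ degExp μ y) n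
degExp-difference μ x y n = begin
  degExp μ (x + y) (suc n) - e
    ≈⟨ +-congʳ (degExp-+ μ x y (suc n)) ⟩
  (degExp μ x 0 * e + r) - e
    ≈⟨ +-cong (+-congʳ (≈-trans (*-congʳ (degExp₀ μ x)) (*-identityˡ e))) (-‿cong (≈-sym (+-identityʳ e))) ⟩
  (e + r) - (e + 0ℝ)
    ≈⟨ [x+y]-[x+z]≈y-z e r 0ℝ ⟩
  r - 0ℝ
    ≈⟨ x-0≈x r ⟩
  r ∎
  where
  e r : ℝ
  e = degExp μ y (suc n)
  r = ((degExp μ x ∘ suc) ⊛ degExp μ y) n

-- Here e_μ^μ(t) = 1 + μt: from degree 2 on, the falling factorial contains the factor μ - μ. Hence
-- the shifted series in `degExp-difference` is the constant μ.
degExp-step : ∀ μ y n →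
  degExp μ (μ + y) (suc n) - degExp μ y (suc n) ≈ μ * degExp μ y n
degExp-step μ y n = begin
  degExp μ (μ + y) (suc n) - degExp μ y (suc n)
    ≈⟨ degExp-difference μ μ y n ⟩
  ((degExp μ μ ∘ suc) ⊛ degExp μ y) n
    ≈⟨ ⊛-constantˡ (degExp μ μ ∘ suc) (degExp μ y) vanish n ⟩
  degExp μ μ 1 * degExp μ y n
    ≈⟨ *-congʳ (≈-trans (*-identityʳ _) (≈-trans (*-identityˡ _) (x-0≈x μ))) ⟩
  μ * degExp μ y n ∎
  where
  ↓-vanish : ∀ k → μ ↓[ μ ] suc (suc k) ≈ 0ℝ
  ↓-vanish zero    = ≈-trans (*-congˡ (≈-trans (+-congˡ (-‿cong (×-homo-1 μ))) (-‿inverseʳ μ))) (zeroʳ _)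
  ↓-vanish (suc k) = ≈-trans (*-congʳ (↓-vanish k)) (zeroˡ _)
  vanish : ∀ k → degExp μ μ (suc (suc k)) ≈ 0ℝ
  vanish k = ≈-trans (*-congʳ (↓-vanish k)) (zeroˡ _)

degExp-0 : ∀ μ k → degExp μ 0ℝ (suc k) ≈ 0ℝ
degExp-0 μ k = ≈-trans (*-congʳ (↓-vanish k)) (zeroˡ _)
  where
  ↓-vanish : ∀ k → 0ℝ ↓[ μ ] suc k ≈ 0ℝ
  ↓-vanish zero    = ≈-trans (*-congˡ (x-0≈x 0ℝ)) (zeroʳ _)
  ↓-vanish (suc k) = ≈-trans (*-congʳ (↓-vanish k)) (zeroˡ _)

-- Comparing coefficients by differences with step `ƛ`

*-cancelˡ-# : ∀ c → c # 0ℝ → ∀ {x y} → c * x ≈ c * y → x ≈ y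
*-cancelˡ-# c c#0 {x} {y} eq = begin
  x                  ≈⟨ scale x ⟨
  inv c c#0 * (c * x) ≈⟨ *-congˡ eq ⟩
  inv c c#0 * (c * y) ≈⟨ scale y ⟩
  y                  ∎
  where
  scale : ∀ z → inv c c#0 * (c * z) ≈ z
  scale z = begin
    inv c c#0 * (c * z) ≈⟨ *-assoc _ _ _ ⟨
    (inv c c#0 * c) * z ≈⟨ *-congʳ (≈-trans (*-comm _ _) (inv-inverseʳ c c#0)) ⟩
    1ℝ * z              ≈⟨ *-identityˡ z ⟩
    z                   ∎

-- By `degExp-step`, the difference with step `ƛ` is `ƛ` times the index shift on the basis. Keeping
-- `ƛ` as a factor on the left avoids division.
scaled-difference : ∀ ƛ n (a : ℕ → ℝ) y →
  ƛ * (∑[ k ≤ n ] a (suc k) * degExp ƛ y k)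
    ≈ (∑[ k ≤ suc n ] a k * degExp ƛ (ƛ + y) k) - (∑[ k ≤ suc n ] a k * degExp ƛ y k)
scaled-difference ƛ n a y = begin
  ƛ * (∑[ k ≤ n ] a (suc k) * degExp ƛ y k)
    ≈⟨ sumTo-*ˡ n ƛ (λ k → a (suc k) * degExp ƛ y k) ⟩
  ∑[ k ≤ n ] ƛ * (a (suc k) * degExp ƛ y k)
    ≈⟨ sumTo-cong n _ (λ k → a (suc k) * (degExp ƛ (ƛ + y) (suc k) - degExp ƛ y (suc k))) (λ k → ≈-trans
         (solve 3 (λ l a e → l :* (a :* e) := a :* (l :* e)) ≈-refl ƛ (a (suc k)) (degExp ƛ y k))
         (*-congˡ (≈-sym (degExp-step ƛ y k)))) ⟩
  ∑[ k ≤ n ] a (suc k) * (degExp ƛ (ƛ + y) (suc k) - degExp ƛ y (suc k))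
    ≈⟨ sumTo-difference n a (degExp ƛ (ƛ + y)) (degExp ƛ y) ≈-refl ⟨
  (∑[ k ≤ suc n ] a k * degExp ƛ (ƛ + y) k) - (∑[ k ≤ suc n ] a k * degExp ƛ y k) ∎

-- Evaluating at y = 0 identifies the constant coefficients; the difference
-- with step ƛ lowers the degree.
degExp-independent : ∀ ƛ → ƛ # 0ℝ → ∀ n (a b : ℕ → ℝ) →
  (∀ y → ∑[ k ≤ n ] a k * degExp ƛ y k ≈ ∑[ k ≤ n ] b k * degExp ƛ y k) →
  ∀ k → k ≤ n → a k ≈ b k
degExp-independent ƛ ƛ#0 n a b eq zero _ = begin
  a 0                                ≈⟨ at-0 n a ⟨
  ∑[ k ≤ n ] a k * degExp ƛ 0ℝ k     ≈⟨ eq 0ℝ ⟩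
  ∑[ k ≤ n ] b k * degExp ƛ 0ℝ k     ≈⟨ at-0 n b ⟩
  b 0                                ∎
  where
  head : ∀ c → c 0 * degExp ƛ 0ℝ 0 ≈ c 0
  head c = ≈-trans (*-congˡ (degExp₀ ƛ 0ℝ)) (*-identityʳ _)
  at-0 : ∀ n (c : ℕ → ℝ) → ∑[ k ≤ n ] c k * degExp ƛ 0ℝ k ≈ c 0
  at-0 zero    c = ≈-trans (+-identityʳ _) (head c)
  at-0 (suc n) c = ≈-trans
    (+-cong (head c) (sumTo-0 n λ k → ≈-trans (*-congˡ (degExp-0 ƛ k)) (zeroʳ (c (suc k)))))
    (+-identityʳ _)
degExp-independent ƛ ƛ#0 (suc n) a b eq (suc k) (s≤s k≤n) =
  degExp-independent ƛ ƛ#0 n (a ∘ suc) (b ∘ suc) (λ y → *-cancelˡ-# ƛ ƛ#0 (begin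
    ƛ * (∑[ k ≤ n ] a (suc k) * degExp ƛ y k)
      ≈⟨ scaled-difference ƛ n a y ⟩
    (∑[ k ≤ suc n ] a k * degExp ƛ (ƛ + y) k) - (∑[ k ≤ suc n ] a k * degExp ƛ y k)
      ≈⟨ +-cong (eq (ƛ + y)) (-‿cong (eq y)) ⟩
    (∑[ k ≤ suc n ] b k * degExp ƛ (ƛ + y) k) - (∑[ k ≤ suc n ] b k * degExp ƛ y k)
      ≈⟨ scaled-difference ƛ n b y ⟨
    ƛ * (∑[ k ≤ n ] b (suc k) * degExp ƛ y k) ∎)) k k≤n

-- Degenerate Bernoulli polynomials

-- Coefficient `k` is β_{k,λ}(x) / k!, without the factorial of `degBernoulli`.
bernoulliSeries : ℝ → ℝ → PowerSeries
bernoulliSeries ƛ x = t/[degExp-1] ƛ ⊛ degExp ƛ x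

-- The shifted series is (e_λ(t) - 1) / t, of which `t/[degExp-1]` is the reciprocal, so
-- associativity cancels the two.
bernoulliSeries-correct : ∀ ƛ x → (degExp ƛ 1ℝ ∘ suc) ⊛ bernoulliSeries ƛ x ≋ degExp ƛ x
bernoulliSeries-correct ƛ x n = begin
  (E ⊛ (T ⊛ degExp ƛ x)) n    ≈⟨ ⊛-assoc E T (degExp ƛ x) n ⟨
  ((E ⊛ T) ⊛ degExp ƛ x) n    ≈⟨ ⊛-congʳ (degExp ƛ x) (reciprocal-inverseʳ E (degExp₁ ƛ)) n ⟩
  (𝟙 ⊛ degExp ƛ x) n          ≈⟨ ⊛-constantˡ 𝟙 (degExp ƛ x) (λ _ → ≈-refl) n ⟩
  1ℝ * degExp ƛ x n           ≈⟨ *-identityˡ _ ⟩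
  degExp ƛ x n                ∎
  where
  E T : PowerSeries
  E = degExp ƛ 1ℝ ∘ suc
  T = t/[degExp-1] ƛ

-- With L the functional sending degExp ƛ y k to bernoulliSeries ƛ x k, this is
-- ƛ L(Δp) = p(ƛ + x) - p(x) for p(y) = degExp 1ℝ y (suc n), where Δp(y) = p(1 + y) - p(y).
bernoulli-functional : ∀ ƛ → ƛ # 0ℝ → ∀ x (σ : ℕ → ℕ → ℝ) →
  (∀ n y → degExp 1ℝ y n ≈ ∑[ k ≤ n ] σ n k * degExp ƛ y k) → ∀ n →
  ƛ * (∑[ k ≤ n ] σ n k * bernoulliSeries ƛ x k)
    ≈ degExp 1ℝ (ƛ + x) (suc n) - degExp 1ℝ x (suc n)
bernoulli-functional ƛ ƛ#0 x σ expand n = begin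
  ƛ * (∑[ k ≤ n ] σ n k * b k)
    ≈⟨ *-congˡ (sumTo-cong-≤ n (λ k k≤n → *-congʳ {b k} (coefficients k k≤n))) ⟩
  ƛ * (∑[ k ≤ n ] adjoint n E (σ (suc n) ∘ suc) k * b k)
    ≈⟨ *-congˡ (adjoint-correct n E (σ (suc n) ∘ suc) b) ⟨
  ƛ * (∑[ k ≤ n ] σ (suc n) (suc k) * (E ⊛ b) k)
    ≈⟨ *-congˡ (sumTo-*-congˡ n (σ (suc n) ∘ suc) (bernoulliSeries-correct ƛ x)) ⟩
  ƛ * (∑[ k ≤ n ] σ (suc n) (suc k) * degExp ƛ x k)
    ≈⟨ scaled-difference ƛ n (σ (suc n)) x ⟩
  (∑[ k ≤ suc n ] σ (suc n) k * degExp ƛ (ƛ + x) k) - (∑[ k ≤ suc n ] σ (suc n) k * degExp ƛ x k)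
    ≈⟨ +-cong (expand (suc n) (ƛ + x)) (-‿cong (expand (suc n) x)) ⟨
  degExp 1ℝ (ƛ + x) (suc n) - degExp 1ℝ x (suc n) ∎
  where
  E b : PowerSeries
  E = degExp ƛ 1ℝ ∘ suc
  b = bernoulliSeries ƛ x
  -- The unit-step difference of binom(y, n + 1) is binom(y, n). Expanding both in the basis
  -- `degExp ƛ y` and comparing coefficients expresses row `n` of `σ` through row `suc n`.
  coefficients : ∀ k → k ≤ n → σ n k ≈ adjoint n E (σ (suc n) ∘ suc) k
  coefficients = degExp-independent ƛ ƛ#0 n (σ n) _ λ y → begin
    ∑[ k ≤ n ] σ n k * degExp ƛ y k
      ≈⟨ expand n y ⟨
    degExp 1ℝ y n
      ≈⟨ *-identityˡ _ ⟨
    1ℝ * degExp 1ℝ y n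
      ≈⟨ degExp-step 1ℝ y n ⟨
    degExp 1ℝ (1ℝ + y) (suc n) - degExp 1ℝ y (suc n)
      ≈⟨ +-cong (expand (suc n) (1ℝ + y)) (-‿cong (expand (suc n) y)) ⟩
    (∑[ k ≤ suc n ] σ (suc n) k * degExp ƛ (1ℝ + y) k) - (∑[ k ≤ suc n ] σ (suc n) k * degExp ƛ y k)
      ≈⟨ sumTo-difference n (σ (suc n)) (degExp ƛ (1ℝ + y)) (degExp ƛ y) ≈-refl ⟩
    ∑[ k ≤ n ] σ (suc n) (suc k) * (degExp ƛ (1ℝ + y) (suc k) - degExp ƛ y (suc k))
      ≈⟨ sumTo-*-congˡ n (σ (suc n) ∘ suc) (degExp-difference ƛ 1ℝ y) ⟩
    ∑[ k ≤ n ] σ (suc n) (suc k) * (E ⊛ degExp ƛ y) k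
      ≈⟨ adjoint-correct n E (σ (suc n) ∘ suc) (degExp ƛ y) ⟩
    ∑[ k ≤ n ] adjoint n E (σ (suc n) ∘ suc) k * degExp ƛ y k ∎

-- Ordinary falling factorials as degenerate ones, and their rescaling

↓≡↓[1] : ∀ y k → y ↓ k ≡ y ↓[ 1ℝ ] k
↓≡↓[1] y zero    = refl
↓≡↓[1] y (suc k) = cong (_* (y - k × 1ℝ)) (↓≡↓[1] y k)

binom≡degExp : ∀ y k → binom y k ≡ degExp 1ℝ y k
binom≡degExp y k = cong (_/! k) (↓≡↓[1] y k)

-- Each factor is rescaled separately: λ - j = λ (1 - j/λ).
↓[1]-rescale : ∀ ƛ (ƛ#0 : ƛ # 0ℝ) k → ƛ ↓[ 1ℝ ] k ≈ (ƛ ^ k) * (1ℝ ↓[ inv ƛ ƛ#0 ] k)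
↓[1]-rescale ƛ ƛ#0 zero    = ≈-sym (*-identityˡ 1ℝ)
↓[1]-rescale ƛ ƛ#0 (suc k) = begin
  (ƛ ↓[ 1ℝ ] k) * (ƛ - k × 1ℝ)
    ≈⟨ *-cong (↓[1]-rescale ƛ ƛ#0 k) (≈-sym factor) ⟩
  ((ƛ ^ k) * (1ℝ ↓[ ƛ⁻¹ ] k)) * (ƛ * (1ℝ - k × ƛ⁻¹))
    ≈⟨ solve 4 (λ p q l d → (p :* q) :* (l :* d) := (l :* p) :* (q :* d)) ≈-refl
         (ƛ ^ k) (1ℝ ↓[ ƛ⁻¹ ] k) ƛ (1ℝ - k × ƛ⁻¹) ⟩
  (ƛ * (ƛ ^ k)) * ((1ℝ ↓[ ƛ⁻¹ ] k) * (1ℝ - k × ƛ⁻¹)) ∎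
  where
  ƛ⁻¹ : ℝ
  ƛ⁻¹ = inv ƛ ƛ#0
  factor : ƛ * (1ℝ - k × ƛ⁻¹) ≈ ƛ - k × 1ℝ
  factor = begin
    ƛ * (1ℝ - k × ƛ⁻¹)       ≈⟨ *-distribˡ-- ƛ 1ℝ (k × ƛ⁻¹) ⟩
    ƛ * 1ℝ - ƛ * (k × ƛ⁻¹)   ≈⟨ +-cong (*-identityʳ ƛ) (-‿cong (≈-trans (×-comm-* k ƛ ƛ⁻¹) (×-congʳ k (inv-inverseʳ ƛ ƛ#0)))) ⟩
    ƛ - k × 1ℝ               ∎

theorem6 : (ƛ : ℝ) (ƛ#0 : ƛ # 0ℝ) (x : ℝ) (n : ℕ) →
    (S : ℕ → ℕ → ℝ) → IsDegStirling₁ ƛ S →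
    ∑[ k ≤ n ] degBernoulli ƛ k x * S n k
    ≈ (n !) × (∑[ k ≤ n ] binom x k *
    (((ƛ ^ (n ∸ k)) * (1ℝ ↓[ inv ƛ ƛ#0 ] (n ∸ k +ℕ 1))) /! (n ∸ k +ℕ 1)))
theorem6 ƛ ƛ#0 x n S isS = begin
  ∑[ k ≤ n ] degBernoulli ƛ k x * S n k
    ≈⟨ sumTo-cong n _ _ (λ k → ≈-trans (*-comm _ _) (≈-trans (×-comm-* (k !) (S n k) (b k))
         (≈-trans (≈-sym (×-assoc-* (k !) (S n k) (b k))) (scale k)))) ⟩
  ∑[ k ≤ n ] ((n !) × (σ n k * b k))
    ≈⟨ sumTo-× n (n !) (λ k → σ n k * b k) ⟨
  (n !) × (∑[ k ≤ n ] σ n k * b k)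
    -- The two sums are compared after multiplication by the invertible `ƛ`, the form in which
    -- `bernoulli-functional` applies.
    ≈⟨ ×-congʳ (n !) (*-cancelˡ-# ƛ ƛ#0 (begin
         ƛ * (∑[ k ≤ n ] σ n k * b k)
           ≈⟨ bernoulli-functional ƛ ƛ#0 x σ expand n ⟩
         degExp 1ℝ (ƛ + x) (suc n) - degExp 1ℝ x (suc n)
           ≈⟨ degExp-difference 1ℝ ƛ x n ⟩
         ((degExp 1ℝ ƛ ∘ suc) ⊛ degExp 1ℝ x) n
           -- Commuting the product makes the index `k` run along the factor in `x`, as in the sum
           -- to be reached.
           ≈⟨ ⊛-comm (degExp 1ℝ ƛ ∘ suc) (degExp 1ℝ x) n ⟩
         ∑[ k ≤ n ] degExp 1ℝ x k * degExp 1ℝ ƛ (suc (n ∸ k))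
           ≈⟨ sumTo-cong n _ _ (λ k → ≈-trans
                (*-cong (reflexive (≡.sym (binom≡degExp x k))) (coefficient (n ∸ k)))
                (solve 3 (λ e l c → e :* (l :* c) := l :* (e :* c)) ≈-refl (binom x k) ƛ (c (n ∸ k)))) ⟩
         ∑[ k ≤ n ] ƛ * (binom x k * c (n ∸ k))
           ≈⟨ sumTo-*ˡ n ƛ (λ k → binom x k * c (n ∸ k)) ⟨
         ƛ * (∑[ k ≤ n ] binom x k * c (n ∸ k)) ∎)) ⟩
  (n !) × (∑[ k ≤ n ] binom x k * c (n ∸ k)) ∎
  where
  b : PowerSeries
  b = bernoulliSeries ƛ x
  σ : ℕ → ℕ → ℝ
  -- The coefficient of (y)_{k,λ} / k! in the expansion of binom(y, m).
  σ m k = ((k !) × S m k) /! m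
  c : ℕ → ℝ
  -- This equals binom(λ, m + 1) / λ, as `coefficient` shows.
  c m = ((ƛ ^ m) * (1ℝ ↓[ inv ƛ ƛ#0 ] (m +ℕ 1))) /! (m +ℕ 1)
  scale : ∀ k → ((k !) × S n k) * b k ≈ (n !) × (σ n k * b k)
  scale k = ≈-trans (*-congʳ (≈-sym (!×/! n _))) (×-assoc-* (n !) (σ n k) (b k))
  expand : ∀ m y → degExp 1ℝ y m ≈ ∑[ k ≤ m ] σ m k * degExp ƛ y k
  expand m y = begin
    degExp 1ℝ y m
      ≡⟨ binom≡degExp y m ⟨
    (y ↓ m) /! m
      ≈⟨ /!-cong m (isS m y) ⟩
    (∑[ k ≤ m ] S m k * (y ↓[ ƛ ] k)) /! m
      ≈⟨ sumTo-*ʳ m (λ k → S m k * (y ↓[ ƛ ] k)) _ ⟩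
    ∑[ k ≤ m ] (S m k * (y ↓[ ƛ ] k)) /! m
      ≈⟨ sumTo-cong m _ (λ k → σ m k * degExp ƛ y k) (λ k → ≈-trans
           (*-congʳ (≈-trans (*-congˡ (≈-sym (!×/! k _)))
             (≈-trans (×-comm-* (k !) _ _) (≈-sym (×-assoc-* (k !) _ _)))))
           (solve 3 (λ s e i → (s :* e) :* i := (s :* i) :* e) ≈-refl ((k !) × S m k) (degExp ƛ y k) (fromℚ ((+ 1 ℚ./ m !) {{m ℕ.!≢0}})))) ⟩
    ∑[ k ≤ m ] σ m k * degExp ƛ y k ∎
  coefficient : ∀ m → degExp 1ℝ ƛ (suc m) ≈ ƛ * c m
  -- `m +ℕ 1` is turned into `suc m`, so that the power unfolds and one factor `ƛ` can be taken out.
  coefficient m rewrite ℕ.+-comm m 1 = begin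
    (ƛ ↓[ 1ℝ ] suc m) /! suc m
      ≈⟨ /!-cong (suc m) (≈-trans (↓[1]-rescale ƛ ƛ#0 (suc m)) (*-assoc _ _ _)) ⟩
    (ƛ * ((ƛ ^ m) * (1ℝ ↓[ inv ƛ ƛ#0 ] suc m))) /! suc m
      ≈⟨ *-assoc _ _ _ ⟩
    ƛ * (((ƛ ^ m) * (1ℝ ↓[ inv ƛ ƛ#0 ] suc m)) /! suc m) ∎
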